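{- $\mathbf{JID}\subseteq\mathbf{Dms_2}$, but $\mathbf{JID}\not\subseteq\mathbf{Dms_1}$.
   Context: A semi-Heyting algebra is an algebra $\langle L,\vee,\wedge,\to,0,1\rangle$ such that $\langle L,\vee,\wedge,0,1\rangle$ is a bounded lattice and the identities $x\wedge(x\to y)\approx x\wedge y$, $x\wedge(y\to z)\approx x\wedge[(x\wedge y)\to(x\wedge z)]$, $x\to x\approx 1$ hold; write $x^*:=x\to 0$. A $\mathbf{DQD}$-algebra (dually quasi-De Morgan semi-Heyting algebra) is an algebra $\langle L,\vee,\wedge,\to,{}',0,1\rangle$ whose reduct $\langle L,\vee,\wedge,\to,0,1\rangle$ is a semi-Heyting algebra and which satisfies: $0'\approx 1$ and $1'\approx 0$; $(x\wedge y)'\approx x'\vee y'$; $(x\vee y)''\approx x''\vee y''$; $x''\le x$. $\mathbf{DQD}$ denotes the variety of all $\mathbf{DQD}$-algebras. $\mathbf{JID}$ is the subvariety of $\mathbf{DQD}$ defined by $x'\vee(y\to z)\approx(x'\vee y)\to(x'\vee z)$, and $\mathbf{Dms}$ is the subvariety of $\mathbf{DQD}$ defined by $(x\vee y)'\approx x'\wedge y'$. Levels: put $x^{(0)}:=x$ and $x^{(n+1)}:=((x^{(n)})')^*$; put $t_0(x):=x$ and $t_{n+1}(x):=t_n(x)\wedge x^{(n+1)}$. $\mathbf{DQD_n}$ is the subvariety of $\mathbf{DQD}$ defined by $t_n(x)\approx t_{n+1}(x)$, and for a subvariety $\mathbf{V}$ of $\mathbf{DQD}$, $\mathbf{V_n}:=\mathbf{V}\cap\mathbf{DQD_n}$.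 -}

module Defs where

open import Algebra.Core using (Op₁; Op₂)
open import Algebra.Definitions using (Congruent₁; Congruent₂; Identity)
open import Algebra.Lattice.Bundles using (Lattice)
open import Data.Nat.Base using (ℕ; zero; suc)
open import Level using (Level; _⊔_) renaming (suc to lsuc)
open import Relation.Unary using (Pred; _∩_)
import Relation.Binary.Construct.NaturalOrder.Left as LeftOrder

record SemiHeytingAlgebra (c ℓ : Level) : Set (lsuc (c ⊔ ℓ)) where
  infixr 5 _⇒_
  infix  9 _*
  field
    lattice : Lattice c ℓ

  open Lattice lattice public

  field
    _⇒_          : Op₂ Carrier
    ⊥            : Carrier
    ⊤            : Carrier
    ∨-identity   : Identity _≈_ ⊥ _∨_
    ∧-identity   : Identity _≈_ ⊤ _∧_
    ⇒-cong       : Congruent₂ _≈_ _⇒_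
    ∧-⇒          : ∀ x y → (x ∧ (x ⇒ y)) ≈ (x ∧ y)
    ∧-⇒-relative : ∀ x y z → (x ∧ (y ⇒ z)) ≈ (x ∧ ((x ∧ y) ⇒ (x ∧ z)))
    ⇒-refl       : ∀ x → (x ⇒ x) ≈ ⊤

  -- The lattice order: x ≤ y unfolds to x ≈ (x ∧ y).
  open LeftOrder _≈_ _∧_ public using (_≤_)

  _* : Op₁ Carrier
  x * = x ⇒ ⊥

record DQDAlgebra (c ℓ : Level) : Set (lsuc (c ⊔ ℓ)) where
  infix 9 _′
  field
    semiHeytingAlgebra : SemiHeytingAlgebra c ℓ

  open SemiHeytingAlgebra semiHeytingAlgebra public

  field
    _′          : Op₁ Carrier
    ′-cong      : Congruent₁ _≈_ _′
    ⊥-′         : (⊥ ′) ≈ ⊤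
    ⊤-′         : (⊤ ′) ≈ ⊥
    ′-∧         : ∀ x y → ((x ∧ y) ′) ≈ ((x ′) ∨ (y ′))
    ′′-∨        : ∀ x y → (((x ∨ y) ′) ′) ≈ (((x ′) ′) ∨ ((y ′) ′))
    ′′-decrease : ∀ x → ((x ′) ′) ≤ x

  iter : ℕ → Op₁ Carrier
  iter zero    x = x
  iter (suc n) x = ((iter n x) ′) *

  t : ℕ → Op₁ Carrier
  t zero    x = x
  t (suc n) x = t n x ∧ iter (suc n) x

-- A subvariety of DQD is given as the predicate on DQD-algebras that its
-- defining identity holds.
module _ {c ℓ : Level} where

  JID : Pred (DQDAlgebra c ℓ) (c ⊔ ℓ)
  JID A = ∀ x y z → ((x ′) ∨ (y ⇒ z)) ≈ (((x ′) ∨ y) ⇒ ((x ′) ∨ z))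
    where open DQDAlgebra A

  Dms : Pred (DQDAlgebra c ℓ) (c ⊔ ℓ)
  Dms A = ∀ x y → ((x ∨ y) ′) ≈ ((x ′) ∧ (y ′))
    where open DQDAlgebra A

  DQD-level : ℕ → Pred (DQDAlgebra c ℓ) (c ⊔ ℓ)
  DQD-level n A = ∀ x → t n x ≈ t (suc n) x
    where open DQDAlgebra A

  infix 8 _at-level_

  -- V at-level n is the variety written Vₙ.
  _at-level_ : Pred (DQDAlgebra c ℓ) (c ⊔ ℓ) → ℕ → Pred (DQDAlgebra c ℓ) (c ⊔ ℓ)
  V at-level n = V ∩ DQD-level n

{-# OPTIONS --safe #-}
module Submission where

-- Inclusion.  A semi-Heyting algebra is a Heyting algebra for the residual
-- x ⇒ (x ∧ y), hence a distributive lattice in which x * is the complement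
-- of x as soon as x has one.  In a DQD-algebra call x closed if x ′ ′ ≈ x.
-- Every x ′ is closed, joins of closed elements are closed, and so are
-- complements of closed elements (`complement-closed`).  The identity JID
-- with y = x ′ and z = ⊥ reads x ′ ∨ (x ′) * ≈ ⊤, so each x ′ is complemented
-- (`′-complemented`).  Therefore x ′ ∧ y ′, being the complement of the closed
-- element (x ′) * ∨ (y ′) *, is closed; this is the nontrivial half of
-- (x ∨ y) ′ ≈ x ′ ∧ y ′ (`JID⊆Dms`).  By that De Morgan law, ′ carries
-- complements to complements, so on closed complemented elements x ↦ (x ′) *
-- is an involution.  Hence iter 3 x ≈ iter 1 x, which makes the factor that
-- t 3 adds to t 2 redundant.
--
-- Non-inclusion.  Let L be the Heyting algebra 2 × 3, a product of chains, and
-- let (i , j) ′ be the pair (¬ [ j is top ] , ¬ [ i is top ]) of bounds.  Each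
-- component of x ′ is a bound of its chain, which gives JID.  For x = (1 , m)
-- with m the middle element of the 3-chain, x ′ = (1 , 0), so
-- t 1 x = x ∧ (0 , 1) = (0 , m), whereas iter 2 x = (1 , 0) and t 2 x = (0 , 0).

open import Defs
open import Algebra.Core using (Op₁; Op₂)
import Algebra.Lattice.Properties.Lattice as LatticeProperties
open import Data.Bool.Base using (if_then_else_)
open import Data.Fin.Base using (Fin; zero; fromℕ)
open import Data.Fin.Patterns using (1F)
open import Data.Fin.Properties using (_≟_; _≤?_; all?)
open import Data.Nat.Base using (ℕ; suc)
open import Data.Product.Base using (_×_; _,_; proj₁; proj₂)
open import Data.Product.Properties using (≡-dec)
open import Level using (Level; Lift; lift; lower)
open import Relation.Binary.Definitions using (DecidableEquality)
open import Relation.Binary.Lattice using (HeytingAlgebra)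
import Relation.Binary.Lattice.Properties.BoundedLattice as BoundedLatticeProperties
import Relation.Binary.Lattice.Properties.DistributiveLattice as DistributiveLatticeProperties
import Relation.Binary.Lattice.Properties.HeytingAlgebra as HeytingAlgebraProperties
open import Relation.Binary.PropositionalEquality as ≡ using (_≡_; cong; cong₂)
import Relation.Binary.Reasoning.Setoid as SetoidReasoning
open import Relation.Nullary.Decidable using (Dec; does; from-yes; map′)
open import Relation.Nullary.Negation using (¬_)
open import Relation.Unary using (Pred; Decidable; _⊆_; _⊈_)

private
  variable
    c ℓ : Level

-- Semi-Heyting algebras as Heyting algebras

module SemiHeytingProperties (S : SemiHeytingAlgebra c ℓ) where

  open SemiHeytingAlgebra S
  open LatticeProperties lattice
    using (∧-idem; ∨-∧-isOrderTheoreticLattice)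
  open SetoidReasoning setoid

  ∧-identityˡ : ∀ x → ⊤ ∧ x ≈ x
  ∧-identityˡ = proj₁ ∧-identity

  ∧-identityʳ : ∀ x → x ∧ ⊤ ≈ x
  ∧-identityʳ = proj₂ ∧-identity

  ∨-identityˡ : ∀ x → ⊥ ∨ x ≈ x
  ∨-identityˡ = proj₁ ∨-identity

  ∨-identityʳ : ∀ x → x ∨ ⊥ ≈ x
  ∨-identityʳ = proj₂ ∨-identity

  ⊥-minimum : ∀ x → ⊥ ≤ x
  ⊥-minimum x = begin
    ⊥            ≈⟨ ∧-absorbs-∨ ⊥ x ⟨
    ⊥ ∧ (⊥ ∨ x)  ≈⟨ ∧-congˡ (∨-identityˡ x) ⟩
    ⊥ ∧ x        ∎

  curry : ∀ w x y → w ∧ x ≤ y → w ≤ (x ⇒ (x ∧ y))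
  curry w x y w∧x≤y = sym (begin
    w ∧ (x ⇒ (x ∧ y))              ≈⟨ ∧-⇒-relative w x (x ∧ y) ⟩
    w ∧ ((w ∧ x) ⇒ (w ∧ (x ∧ y)))  ≈⟨ ∧-congˡ (⇒-cong refl (∧-assoc w x y)) ⟨
    w ∧ ((w ∧ x) ⇒ ((w ∧ x) ∧ y))  ≈⟨ ∧-congˡ (⇒-cong refl w∧x≤y) ⟨
    w ∧ ((w ∧ x) ⇒ (w ∧ x))        ≈⟨ ∧-congˡ (⇒-refl (w ∧ x)) ⟩
    w ∧ ⊤                          ≈⟨ ∧-identityʳ w ⟩
    w                              ∎)

  uncurry : ∀ w x y → w ≤ (x ⇒ (x ∧ y)) → w ∧ x ≤ y
  uncurry w x y w≤ = begin
    w ∧ x        ≈⟨ w∧x≈w∧x∧y ⟩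
    w ∧ (x ∧ y)  ≈⟨ ∧-assoc w x y ⟨
    (w ∧ x) ∧ y  ∎
    where
    w∧x≈w∧x∧y : w ∧ x ≈ w ∧ (x ∧ y)
    w∧x≈w∧x∧y = begin
      w ∧ x                    ≈⟨ ∧-congʳ w≤ ⟩
      (w ∧ (x ⇒ (x ∧ y))) ∧ x  ≈⟨ ∧-assoc w _ x ⟩
      w ∧ ((x ⇒ (x ∧ y)) ∧ x)  ≈⟨ ∧-congˡ (∧-comm _ x) ⟩
      w ∧ (x ∧ (x ⇒ (x ∧ y)))  ≈⟨ ∧-congˡ (∧-⇒ x (x ∧ y)) ⟩
      w ∧ (x ∧ (x ∧ y))        ≈⟨ ∧-congˡ (∧-assoc x x y) ⟨
      w ∧ ((x ∧ x) ∧ y)        ≈⟨ ∧-congˡ (∧-congʳ (∧-idem x)) ⟩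
      w ∧ (x ∧ y)              ∎

  -- The residual of ∧ is x ⇒ (x ∧ y): the semi-Heyting arrow itself need not
  -- satisfy the adjunction.
  heytingAlgebra : HeytingAlgebra c ℓ ℓ
  heytingAlgebra = record
    { _≈_ = _≈_
    ; _≤_ = _≤_
    ; _∨_ = _∨_
    ; _∧_ = _∧_
    ; _⇨_ = λ x y → x ⇒ (x ∧ y)
    ; ⊤ = ⊤
    ; ⊥ = ⊥
    ; isHeytingAlgebra = record
      { isBoundedLattice = record
        { isLattice = ∨-∧-isOrderTheoreticLattice
        ; maximum   = λ x → sym (∧-identityʳ x)
        ; minimum   = ⊥-minimum
        }
      ; exponential = λ w x y → curry w x y , uncurry w x y
      }
    }

  open HeytingAlgebraProperties heytingAlgebra public
    using (∧-distribˡ-∨; distributiveLattice)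
  open DistributiveLatticeProperties distributiveLattice public
    using (∧-distribʳ-∨; ∨-distribˡ-∧)
  open BoundedLatticeProperties (HeytingAlgebra.boundedLattice heytingAlgebra) public
    using (∧-zeroˡ; ∧-zeroʳ; ∨-zeroˡ; ∨-zeroʳ)

  -- Complements as a relation; they are unique by distributivity.
  Complement : Carrier → Carrier → Set ℓ
  Complement x y = (x ∧ y ≈ ⊥) × (x ∨ y ≈ ⊤)

  Complement-sym : ∀ {x y} → Complement x y → Complement y x
  Complement-sym (x∧y≈⊥ , x∨y≈⊤) =
    trans (∧-comm _ _) x∧y≈⊥ , trans (∨-comm _ _) x∨y≈⊤

  Complement-congˡ : ∀ {x x₁ y} → x ≈ x₁ → Complement x y → Complement x₁ y
  Complement-congˡ x≈x₁ (x∧y≈⊥ , x∨y≈⊤) =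
    trans (∧-congʳ (sym x≈x₁)) x∧y≈⊥ , trans (∨-congʳ (sym x≈x₁)) x∨y≈⊤

  ∧-* : ∀ x → x ∧ x * ≈ ⊥
  ∧-* x = trans (∧-⇒ x ⊥) (∧-zeroʳ x)

  ⊥-* : ⊥ * ≈ ⊤
  ⊥-* = ⇒-refl ⊥

  complement-* : ∀ {x y} → Complement x y → x * ≈ y
  complement-* {x} {y} (x∧y≈⊥ , x∨y≈⊤) = begin
    x *                  ≈⟨ ∧-identityʳ (x *) ⟨
    x * ∧ ⊤              ≈⟨ ∧-congˡ x∨y≈⊤ ⟨
    x * ∧ (x ∨ y)        ≈⟨ ∧-distribˡ-∨ (x *) x y ⟩
    x * ∧ x ∨ x * ∧ y    ≈⟨ ∨-congʳ (trans (∧-comm (x *) x) (∧-* x)) ⟩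
    ⊥ ∨ x * ∧ y          ≈⟨ ∨-identityˡ (x * ∧ y) ⟩
    x * ∧ y              ≈⟨ ∧-comm (x *) y ⟩
    y ∧ x *              ≈⟨ ∧-⇒-relative y x ⊥ ⟩
    y ∧ ((y ∧ x) ⇒ (y ∧ ⊥))
      ≈⟨ ∧-congˡ (⇒-cong (trans (∧-comm y x) x∧y≈⊥) (∧-zeroʳ y)) ⟩
    y ∧ ⊥ *              ≈⟨ ∧-congˡ ⊥-* ⟩
    y ∧ ⊤                ≈⟨ ∧-identityʳ y ⟩
    y                    ∎

  Complement-∧ : ∀ {x y u v} → Complement x u → Complement y v →
                 Complement (u ∨ v) (x ∧ y)
  Complement-∧ {x} {y} {u} {v} (x∧u≈⊥ , x∨u≈⊤) (y∧v≈⊥ , y∨v≈⊤) = meet , join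
    where
    u∧x∧y≈⊥ : u ∧ (x ∧ y) ≈ ⊥
    u∧x∧y≈⊥ = begin
      u ∧ (x ∧ y)  ≈⟨ ∧-assoc u x y ⟨
      (u ∧ x) ∧ y  ≈⟨ ∧-congʳ (trans (∧-comm u x) x∧u≈⊥) ⟩
      ⊥ ∧ y        ≈⟨ ∧-zeroˡ y ⟩
      ⊥            ∎

    v∧x∧y≈⊥ : v ∧ (x ∧ y) ≈ ⊥
    v∧x∧y≈⊥ = begin
      v ∧ (x ∧ y)  ≈⟨ ∧-comm v (x ∧ y) ⟩
      (x ∧ y) ∧ v  ≈⟨ ∧-assoc x y v ⟩
      x ∧ (y ∧ v)  ≈⟨ ∧-congˡ y∧v≈⊥ ⟩
      x ∧ ⊥        ≈⟨ ∧-zeroʳ x ⟩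
      ⊥            ∎

    meet : (u ∨ v) ∧ (x ∧ y) ≈ ⊥
    meet = begin
      (u ∨ v) ∧ (x ∧ y)            ≈⟨ ∧-distribʳ-∨ (x ∧ y) u v ⟩
      u ∧ (x ∧ y) ∨ v ∧ (x ∧ y)    ≈⟨ ∨-cong u∧x∧y≈⊥ v∧x∧y≈⊥ ⟩
      ⊥ ∨ ⊥                        ≈⟨ ∨-identityʳ ⊥ ⟩
      ⊥                            ∎

    u∨v∨x≈⊤ : (u ∨ v) ∨ x ≈ ⊤
    u∨v∨x≈⊤ = begin
      (u ∨ v) ∨ x  ≈⟨ ∨-comm (u ∨ v) x ⟩
      x ∨ (u ∨ v)  ≈⟨ ∨-assoc x u v ⟨
      (x ∨ u) ∨ v  ≈⟨ ∨-congʳ x∨u≈⊤ ⟩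
      ⊤ ∨ v        ≈⟨ ∨-zeroˡ v ⟩
      ⊤            ∎

    u∨v∨y≈⊤ : (u ∨ v) ∨ y ≈ ⊤
    u∨v∨y≈⊤ = begin
      (u ∨ v) ∨ y  ≈⟨ ∨-assoc u v y ⟩
      u ∨ (v ∨ y)  ≈⟨ ∨-congˡ (trans (∨-comm v y) y∨v≈⊤) ⟩
      u ∨ ⊤        ≈⟨ ∨-zeroʳ u ⟩
      ⊤            ∎

    join : (u ∨ v) ∨ (x ∧ y) ≈ ⊤
    join = begin
      (u ∨ v) ∨ (x ∧ y)              ≈⟨ ∨-distribˡ-∧ (u ∨ v) x y ⟩
      ((u ∨ v) ∨ x) ∧ ((u ∨ v) ∨ y)  ≈⟨ ∧-cong u∨v∨x≈⊤ u∨v∨y≈⊤ ⟩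
      ⊤ ∧ ⊤                          ≈⟨ ∧-identityˡ ⊤ ⟩
      ⊤                              ∎

-- Closed elements of a DQD-algebra

module DQDProperties (A : DQDAlgebra c ℓ) where

  open DQDAlgebra A
  open SemiHeytingProperties semiHeytingAlgebra public
  open SetoidReasoning setoid

  -- The map x ↦ x ′ ′ is an interior operator; its fixed points.
  Closed : Carrier → Set ℓ
  Closed x = (x ′) ′ ≈ x

  ′-antitone : ∀ {x y} → x ≤ y → y ′ ≤ x ′
  ′-antitone {x} {y} x≤y = begin
    y ′                ≈⟨ ∧-absorbs-∨ (y ′) (x ′) ⟨
    y ′ ∧ (y ′ ∨ x ′)  ≈⟨ ∧-congˡ (∨-comm (y ′) (x ′)) ⟩
    y ′ ∧ (x ′ ∨ y ′)  ≈⟨ ∧-congˡ (′-∧ x y) ⟨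
    y ′ ∧ (x ∧ y) ′    ≈⟨ ∧-congˡ (′-cong x≤y) ⟨
    y ′ ∧ x ′          ∎

  ′-closed : ∀ x → Closed (x ′)
  ′-closed x = begin
    ((x ′) ′) ′        ≈⟨ ′′-decrease (x ′) ⟩
    ((x ′) ′) ′ ∧ x ′  ≈⟨ ∧-comm _ (x ′) ⟩
    x ′ ∧ ((x ′) ′) ′  ≈⟨ ′-antitone (′′-decrease x) ⟨
    x ′                ∎

  ∨-closed : ∀ {x y} → Closed x → Closed y → Closed (x ∨ y)
  ∨-closed {x} {y} x″≈x y″≈y = trans (′′-∨ x y) (∨-cong x″≈x y″≈y)

  complement-closed : ∀ {x y} → Complement x y → Closed x → Closed y
  complement-closed {x} {y} (x∧y≈⊥ , x∨y≈⊤) x″≈x = begin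
    (y ′) ′                ≈⟨ ′′-decrease y ⟩
    (y ′) ′ ∧ y            ≈⟨ ∧-comm _ y ⟩
    y ∧ (y ′) ′            ≈⟨ ∨-identityˡ (y ∧ (y ′) ′) ⟨
    ⊥ ∨ y ∧ (y ′) ′        ≈⟨ ∨-congʳ (trans (∧-comm y x) x∧y≈⊥) ⟨
    y ∧ x ∨ y ∧ (y ′) ′    ≈⟨ ∧-distribˡ-∨ y x ((y ′) ′) ⟨
    y ∧ (x ∨ (y ′) ′)      ≈⟨ ∧-congˡ x∨y″≈⊤ ⟩
    y ∧ ⊤                  ≈⟨ ∧-identityʳ y ⟩
    y                      ∎
    where
    x∨y″≈⊤ : x ∨ (y ′) ′ ≈ ⊤
    x∨y″≈⊤ = begin
      x ∨ (y ′) ′        ≈⟨ ∨-congʳ x″≈x ⟨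
      (x ′) ′ ∨ (y ′) ′  ≈⟨ ′′-∨ x y ⟨
      ((x ∨ y) ′) ′      ≈⟨ ′-cong (′-cong x∨y≈⊤) ⟩
      (⊤ ′) ′            ≈⟨ ′-cong ⊤-′ ⟩
      ⊥ ′                ≈⟨ ⊥-′ ⟩
      ⊤                  ∎

  Dms⇒′-Complement : Dms A → ∀ {x y} → Complement x y → Complement (x ′) (y ′)
  Dms⇒′-Complement dms {x} {y} (x∧y≈⊥ , x∨y≈⊤) =
    trans (sym (dms x y)) (trans (′-cong x∨y≈⊤) ⊤-′) ,
    trans (sym (′-∧ x y)) (trans (′-cong x∧y≈⊥) ⊥-′)

-- The inclusion

module JIDProperties (A : DQDAlgebra c ℓ) (jid : JID A) where

  open DQDAlgebra A
  open DQDProperties A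
  open LatticeProperties lattice using (∧-idem; ∨-idem)
  open SetoidReasoning setoid

  ′-complemented : ∀ x → Complement (x ′) ((x ′) *)
  ′-complemented x = ∧-* (x ′) , (begin
    x ′ ∨ (x ′) *              ≈⟨ jid x (x ′) ⊥ ⟩
    (x ′ ∨ x ′) ⇒ (x ′ ∨ ⊥)    ≈⟨ ⇒-cong (∨-idem (x ′)) (∨-identityʳ (x ′)) ⟩
    x ′ ⇒ x ′                  ≈⟨ ⇒-refl (x ′) ⟩
    ⊤                          ∎)

  ′*-closed : ∀ x → Closed ((x ′) *)
  ′*-closed x = complement-closed (′-complemented x) (′-closed x)

  ′-∧-closed : ∀ x y → Closed (x ′ ∧ y ′)
  ′-∧-closed x y = complement-closed
    (Complement-∧ (′-complemented x) (′-complemented y))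
    (∨-closed (′*-closed x) (′*-closed y))

  JID⊆Dms : Dms A
  JID⊆Dms x y = begin
    (x ∨ y) ′              ≈⟨ ′-closed (x ∨ y) ⟨
    (((x ∨ y) ′) ′) ′      ≈⟨ ′-cong (′′-∨ x y) ⟩
    ((x ′) ′ ∨ (y ′) ′) ′  ≈⟨ ′-cong (′-∧ (x ′) (y ′)) ⟨
    ((x ′ ∧ y ′) ′) ′      ≈⟨ ′-∧-closed x y ⟩
    x ′ ∧ y ′              ∎

  -- With b = (x ′) *, the elements b ′ and (b ′) * are complements, hence so
  -- are b ≈ (b ′) ′ and ((b ′) *) ′.
  iter-3≈iter-1 : ∀ x → iter 3 x ≈ iter 1 x
  iter-3≈iter-1 x = complement-* (Complement-sym
    (Complement-congˡ (′*-closed x)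
      (Dms⇒′-Complement JID⊆Dms (′-complemented ((x ′) *)))))

  level-2 : DQD-level 2 A
  level-2 x = sym (begin
    ((x ∧ b) ∧ iter 2 x) ∧ iter 3 x  ≈⟨ ∧-congˡ (iter-3≈iter-1 x) ⟩
    ((x ∧ b) ∧ iter 2 x) ∧ b         ≈⟨ ∧-comm _ b ⟩
    b ∧ ((x ∧ b) ∧ iter 2 x)         ≈⟨ ∧-assoc b (x ∧ b) _ ⟨
    (b ∧ (x ∧ b)) ∧ iter 2 x         ≈⟨ ∧-congʳ (∧-comm b (x ∧ b)) ⟩
    ((x ∧ b) ∧ b) ∧ iter 2 x         ≈⟨ ∧-congʳ (∧-assoc x b b) ⟩
    (x ∧ (b ∧ b)) ∧ iter 2 x         ≈⟨ ∧-congʳ (∧-congˡ (∧-idem b)) ⟩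
    (x ∧ b) ∧ iter 2 x               ∎)
    where
    b : Carrier
    b = iter 1 x

-- The six-element algebra 2 × 3

module SixElements where

  -- The chain with suc n elements as a bounded Heyting (Gödel) chain.
  module Chain {n : ℕ} where

    bot top : Fin (suc n)
    bot = zero
    top = fromℕ n

    min max imp : Op₂ (Fin (suc n))
    min i j = if does (i ≤? j) then i else j
    max i j = if does (i ≤? j) then j else i
    imp i j = if does (i ≤? j) then top else j

  open Chain

  -- The crisp negation of one chain with values in another: top goes to
  -- bot, every other element to top.
  notTop : ∀ {m n} → Fin (suc m) → Fin (suc n)
  notTop i = if does (i ≟ top) then bot else top

  -- The product of the two-element and the three-element chain, with the
  -- lattice operations and the arrow taken componentwise.
  Carrier₆ : Set
  Carrier₆ = Fin 2 × Fin 3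

  infixr 7 _⊓_
  infixr 6 _⊔_
  infixr 5 _⇨_
  infix  9 ∼_

  _⊓_ _⊔_ _⇨_ : Op₂ Carrier₆
  (i , j) ⊓ (k , l) = min i k , min j l
  (i , j) ⊔ (k , l) = max i k , max j l
  (i , j) ⇨ (k , l) = imp i k , imp j l

  -- The swap of the two components is essential: without it the algebra
  -- satisfies t 1 x ≈ t 2 x.
  ∼_ : Op₁ Carrier₆
  ∼ (i , j) = notTop j , notTop i

  ⊥₆ ⊤₆ : Carrier₆
  ⊥₆ = bot , bot
  ⊤₆ = top , top

  _≟₆_ : DecidableEquality Carrier₆
  _≟₆_ = ≡-dec _≟_ _≟_

  ∀? : ∀ {p} {P : Pred Carrier₆ p} → Decidable P → Dec (∀ x → P x)
  ∀? P? = map′ (λ h (i , j) → h i j) (λ h i j → h (i , j))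
               (all? λ i → all? λ j → P? (i , j))

  ∀₂? : ∀ {p} {P : Carrier₆ → Carrier₆ → Set p} →
        (∀ x y → Dec (P x y)) → Dec (∀ x y → P x y)
  ∀₂? P? = ∀? λ x → ∀? (P? x)

  ∀₃? : ∀ {p} {P : Carrier₆ → Carrier₆ → Carrier₆ → Set p} →
        (∀ x y z → Dec (P x y z)) → Dec (∀ x y z → P x y z)
  ∀₃? P? = ∀? λ x → ∀₂? (P? x)

  ⊔-comm : ∀ x y → x ⊔ y ≡ y ⊔ x
  ⊔-comm = from-yes (∀₂? λ x y → (x ⊔ y) ≟₆ (y ⊔ x))

  ⊔-assoc : ∀ x y z → (x ⊔ y) ⊔ z ≡ x ⊔ (y ⊔ z)
  ⊔-assoc = from-yes (∀₃? λ x y z → ((x ⊔ y) ⊔ z) ≟₆ (x ⊔ (y ⊔ z)))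

  ⊓-comm : ∀ x y → x ⊓ y ≡ y ⊓ x
  ⊓-comm = from-yes (∀₂? λ x y → (x ⊓ y) ≟₆ (y ⊓ x))

  ⊓-assoc : ∀ x y z → (x ⊓ y) ⊓ z ≡ x ⊓ (y ⊓ z)
  ⊓-assoc = from-yes (∀₃? λ x y z → ((x ⊓ y) ⊓ z) ≟₆ (x ⊓ (y ⊓ z)))

  ⊔-absorbs-⊓ : ∀ x y → x ⊔ (x ⊓ y) ≡ x
  ⊔-absorbs-⊓ = from-yes (∀₂? λ x y → (x ⊔ (x ⊓ y)) ≟₆ x)

  ⊓-absorbs-⊔ : ∀ x y → x ⊓ (x ⊔ y) ≡ x
  ⊓-absorbs-⊔ = from-yes (∀₂? λ x y → (x ⊓ (x ⊔ y)) ≟₆ x)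

  ⊔-identityˡ : ∀ x → ⊥₆ ⊔ x ≡ x
  ⊔-identityˡ = from-yes (∀? λ x → (⊥₆ ⊔ x) ≟₆ x)

  ⊔-identityʳ : ∀ x → x ⊔ ⊥₆ ≡ x
  ⊔-identityʳ = from-yes (∀? λ x → (x ⊔ ⊥₆) ≟₆ x)

  ⊓-identityˡ : ∀ x → ⊤₆ ⊓ x ≡ x
  ⊓-identityˡ = from-yes (∀? λ x → (⊤₆ ⊓ x) ≟₆ x)

  ⊓-identityʳ : ∀ x → x ⊓ ⊤₆ ≡ x
  ⊓-identityʳ = from-yes (∀? λ x → (x ⊓ ⊤₆) ≟₆ x)

  ⊓-⇨ : ∀ x y → x ⊓ (x ⇨ y) ≡ x ⊓ y
  ⊓-⇨ = from-yes (∀₂? λ x y → (x ⊓ (x ⇨ y)) ≟₆ (x ⊓ y))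

  ⊓-⇨-relative : ∀ x y z → x ⊓ (y ⇨ z) ≡ x ⊓ ((x ⊓ y) ⇨ (x ⊓ z))
  ⊓-⇨-relative = from-yes
    (∀₃? λ x y z → (x ⊓ (y ⇨ z)) ≟₆ (x ⊓ ((x ⊓ y) ⇨ (x ⊓ z))))

  ⇨-refl : ∀ x → (x ⇨ x) ≡ ⊤₆
  ⇨-refl = from-yes (∀? λ x → (x ⇨ x) ≟₆ ⊤₆)

  ∼-⊓ : ∀ x y → ∼ (x ⊓ y) ≡ (∼ x) ⊔ (∼ y)
  ∼-⊓ = from-yes (∀₂? λ x y → (∼ (x ⊓ y)) ≟₆ ((∼ x) ⊔ (∼ y)))

  ∼∼-⊔ : ∀ x y → ∼ (∼ (x ⊔ y)) ≡ (∼ (∼ x)) ⊔ (∼ (∼ y))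
  ∼∼-⊔ = from-yes
    (∀₂? λ x y → (∼ (∼ (x ⊔ y))) ≟₆ ((∼ (∼ x)) ⊔ (∼ (∼ y))))

  ∼∼-decrease : ∀ x → ∼ (∼ x) ≡ (∼ (∼ x)) ⊓ x
  ∼∼-decrease = from-yes (∀? λ x → (∼ (∼ x)) ≟₆ ((∼ (∼ x)) ⊓ x))

  ∼-⊔-⇨ : ∀ x y z → (∼ x) ⊔ (y ⇨ z) ≡ (((∼ x) ⊔ y) ⇨ ((∼ x) ⊔ z))
  ∼-⊔-⇨ = from-yes
    (∀₃? λ x y z → ((∼ x) ⊔ (y ⇨ z)) ≟₆ (((∼ x) ⊔ y) ⇨ ((∼ x) ⊔ z)))

  -- The algebra at arbitrary universe levels, with carrier and equality lifted.
  semiHeytingAlgebra₆ : ∀ c ℓ → SemiHeytingAlgebra c ℓ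
  semiHeytingAlgebra₆ c ℓ = record
    { lattice = record
      { Carrier = Lift c Carrier₆
      ; _≈_ = λ x y → Lift ℓ (lower x ≡ lower y)
      ; _∨_ = λ x y → lift (lower x ⊔ lower y)
      ; _∧_ = λ x y → lift (lower x ⊓ lower y)
      ; isLattice = record
        { isEquivalence = record
          { refl  = lift ≡.refl
          ; sym   = λ p → lift (≡.sym (lower p))
          ; trans = λ p q → lift (≡.trans (lower p) (lower q))
          }
        ; ∨-comm     = λ x y → lift (⊔-comm (lower x) (lower y))
        ; ∨-assoc    = λ x y z → lift (⊔-assoc (lower x) (lower y) (lower z))
        ; ∨-cong     = λ p q → lift (cong₂ _⊔_ (lower p) (lower q))
        ; ∧-comm     = λ x y → lift (⊓-comm (lower x) (lower y))
        ; ∧-assoc    = λ x y z → lift (⊓-assoc (lower x) (lower y) (lower z))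
        ; ∧-cong     = λ p q → lift (cong₂ _⊓_ (lower p) (lower q))
        ; absorptive = (λ x y → lift (⊔-absorbs-⊓ (lower x) (lower y)))
                     , (λ x y → lift (⊓-absorbs-⊔ (lower x) (lower y)))
        }
      }
    ; _⇒_ = λ x y → lift (lower x ⇨ lower y)
    ; ⊥ = lift ⊥₆
    ; ⊤ = lift ⊤₆
    ; ∨-identity = (λ x → lift (⊔-identityˡ (lower x)))
                 , (λ x → lift (⊔-identityʳ (lower x)))
    ; ∧-identity = (λ x → lift (⊓-identityˡ (lower x)))
                 , (λ x → lift (⊓-identityʳ (lower x)))
    ; ⇒-cong = λ p q → lift (cong₂ _⇨_ (lower p) (lower q))
    ; ∧-⇒ = λ x y → lift (⊓-⇨ (lower x) (lower y))
    ; ∧-⇒-relative = λ x y z → lift (⊓-⇨-relative (lower x) (lower y) (lower z))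
    ; ⇒-refl = λ x → lift (⇨-refl (lower x))
    }

  dqdAlgebra₆ : ∀ c ℓ → DQDAlgebra c ℓ
  dqdAlgebra₆ c ℓ = record
    { semiHeytingAlgebra = semiHeytingAlgebra₆ c ℓ
    ; _′ = λ x → lift (∼ lower x)
    ; ′-cong = λ p → lift (cong ∼_ (lower p))
    ; ⊥-′ = lift ≡.refl
    ; ⊤-′ = lift ≡.refl
    ; ′-∧ = λ x y → lift (∼-⊓ (lower x) (lower y))
    ; ′′-∨ = λ x y → lift (∼∼-⊔ (lower x) (lower y))
    ; ′′-decrease = λ x → lift (∼∼-decrease (lower x))
    }

  dqdAlgebra₆∈JID : ∀ c ℓ → JID (dqdAlgebra₆ c ℓ)
  dqdAlgebra₆∈JID c ℓ x y z = lift (∼-⊔-⇨ (lower x) (lower y) (lower z))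

  dqdAlgebra₆∉level-1 : ∀ c ℓ → ¬ DQD-level 1 (dqdAlgebra₆ c ℓ)
  dqdAlgebra₆∉level-1 c ℓ level-1
    -- The two sides evaluate to (0 , m) and (0 , 0).
    with () ← lower (level-1 (lift (1F , 1F)))

theorem3p10 : ∀ c ℓ →
    (JID {c} {ℓ} ⊆ Dms at-level 2) × (JID {c} {ℓ} ⊈ Dms at-level 1)
theorem3p10 c ℓ =
  (λ {A} jid → JIDProperties.JID⊆Dms A jid , JIDProperties.level-2 A jid) ,
  (λ JID⊆Dms₁ → SixElements.dqdAlgebra₆∉level-1 c ℓ
    (proj₂ (JID⊆Dms₁ {SixElements.dqdAlgebra₆ c ℓ}
      (SixElements.dqdAlgebra₆∈JID c ℓ))))
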